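{- Let $n$ and $k$ be non-negative integers such that $k\le n$, let $P^n_k$ be the binomial program on the atoms $\mathtt{x}_1,\dots,\mathtt{x}_n$, let $\pi$ be a propagator for the constraint $$\bigl\{\{\mathbf{T}x\mid x\in X\}\ \bigm|\ X\subseteq\{\mathtt{x}_1,\dots,\mathtt{x}_n\},\ |X|=k\bigr\},$$ and let $A_1,\dots,A_m$ be a complete propagator call history for the answer set program $P^n_k$ and $\pi$. Then $m=\binom{n}{k}$.
   Context: **Programs, nogoods, answer sets.** A signed literal is $\mathbf{T}x$ or $\mathbf{F}x$ for an atom $x$. A (partial) assignment $A$ is a consistent set of signed literals (not containing both $\mathbf{T}x$ and $\mathbf{F}x$) over the atoms of the program at hand. A nogood is a finite set of signed literals; a constraint $\Gamma$ is a set of nogoods. $A$ is in conflict with a nogood $\delta$ if $\delta\subseteq A$, and with $\Gamma$ if it is in conflict with some member of $\Gamma$. $A$ satisfies $\delta$ if for some $\mathbf{T}a\in\delta$ we have $\mathbf{F}a\in A$ or for some $\mathbf{F}a\in\delta$ we have $\mathbf{T}a\in A$; it satisfies $\Gamma$ if it satisfies all members. A program $P$ is a set of normal rules $a\leftarrow b_1,\dots,b_r,\mathrm{not}\,c_1,\dots,\mathrm{not}\,c_s$ and nogoods, with signature $\mathrm{At}(P)$ of atoms containing those occurring in $P$; $\mathrm{head}(P)$ is the set of rule heads. An interpretation $I\subseteq\mathrm{At}(P)$ is identified with the total assignment making exactly the atoms in $I$ true; it satisfies a rule if it satisfies the nogood $\{\mathbf{F}a,\mathbf{T}b_1,\dots,\mathbf{T}b_r,\mathbf{F}c_1,\dots,\mathbf{F}c_s\}$,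 and satisfies $P$ if it satisfies all its rules and nogoods. The reduct $P^I$ contains $a\leftarrow b_1,\dots,b_r$ for each rule of $P$ with $\{c_1,\dots,c_s\}\cap I=\emptyset$. An answer set of $P$ is an interpretation $I\subseteq \mathrm{At}(P)$ that satisfies $P$ and is $\subseteq$-minimal among the interpretations $J$ that satisfy all rules of $P^I$ and $J\setminus\mathrm{head}(P)=I\setminus\mathrm{head}(P)$. A supported model of $P$ is an interpretation $I$ satisfying $P$ such that for each $a\in I$ there is a rule of $P$ with head $a$, $\{b_1,\dots,b_r\}\subseteq I$ and $\{c_1,\dots,c_s\}\cap I=\emptyset$. The supported model constraint $\Gamma_{\mathrm{supp}}(P)$ is the set of nogoods $\{\mathbf{T}a\mid a\in I\}\cup\{\mathbf{F}a\mid a\in\mathrm{At}(P)\setminus I\}$ for all $I\subseteq\mathrm{At}(P)$ that are not supported models of $P$. **Binomial program.** $P^n_k$ consists of a choice rule on $\mathtt{x}_1,\dots,\mathtt{x}_n$ and a cardinality constraint requiring at least $k$ of them. Explicitly, it consists of the rules $t\leftarrow$ (a fact), $\mathtt{x}_i\leftarrow\mathrm{not}\,\mathtt{x}'_i,t$ and $\mathtt{x}'_i\leftarrow\mathrm{not}\,\mathtt{x}_i$ for $1\le i\le n$, where $t,\mathtt{x}'_1,\dots,\mathtt{x}'_n$ are fresh auxiliary atoms, together with the nogoods $\{\mathbf{F}x\mid x\in X\}$ for all $X\subseteq\{\mathtt{x}_1,\dots,\mathtt{x}_n\}$ with $|X|=n-k+1$. Its signature consists of these atoms. **Propagators and call histories.**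 A propagator $\pi$ for a constraint $\Gamma$ (denoted $\Gamma_\pi$) is a function from partial assignments $A$ in conflict with $\Gamma$ to nogoods $\pi(A)\in\Gamma$ in conflict with $A$. A propagator call history (PCH) for a program $P$ and $\pi$ is a sequence $A_1,\dots,A_m$ of partial assignments such that for all $1\le i\le m$, $A_i$ satisfies $\Gamma_{\mathrm{supp}}(P)$ and the nogoods $\pi(A_1),\dots,\pi(A_{i-1})$, and conflicts with $\Gamma_\pi$. When $P\cup\Gamma_\pi$ has no answer sets, a PCH $A_1,\dots,A_m$ is complete if $P\cup\{\pi(A_1),\dots,\pi(A_m)\}$ has no answer sets. -}

module Defs where

open import Data.Fin.Base using (Fin; zero; suc; _↑ˡ_; _↑ʳ_; _<_)
open import Data.Fin.Subset
  using (Subset; _∈_; _⊆_; ⊥; ⁅_⁆; ∁; _∩_; _∪_; ∣_∣; Empty; outside)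
open import Data.Nat.Base using (ℕ; suc; _+_; _∸_)
open import Data.Product.Base using (∃; ∃-syntax; _×_)
open import Data.Sum.Base using (_⊎_)
open import Data.Vec.Base using (_∷_; _++_)
open import Data.Vec.Functional using (Vector)
open import Level using (0ℓ)
open import Relation.Binary.PropositionalEquality.Core using (_≡_)
open import Relation.Nullary.Negation.Core using (¬_)
import Relation.Unary as U
open U using (Pred)

-- Throughout, N is the number of atoms and Fin N is the signature.

private
  variable
    N m : ℕ

-- A set of signed literals, as the set of atoms a such that T a belongs to it
-- and the set of atoms a such that F a belongs to it.
record Literals (N : ℕ) : Set where
  constructor ⟨T_,F_⟩
  field
    T : Subset N
    F : Subset N

open Literals public

infix 4 _⊑_

_⊑_ : Literals N → Literals N → Set
δ ⊑ δ′ = T δ ⊆ T δ′ × F δ ⊆ F δ′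

Nogood : ℕ → Set
Nogood = Literals

Constraint : ℕ → Set₁
Constraint N = Pred (Nogood N) 0ℓ

-- Consistency is an irrelevant field, so that an assignment is determined by
-- its literals.
record Assignment (N : ℕ) : Set where
  constructor assignment
  field
    literals    : Literals N
    .consistent : Empty (T literals ∩ F literals)

open Assignment public

ConflictsWith : Assignment N → Nogood N → Set
ConflictsWith A δ = δ ⊑ literals A

InConflict : Assignment N → Constraint N → Set
InConflict A Γ = ∃[ δ ] Γ δ × ConflictsWith A δ

Satisfies : Literals N → Nogood N → Set
Satisfies A δ = ∃[ a ] ((a ∈ T δ × a ∈ F A) ⊎ (a ∈ F δ × a ∈ T A))

SatisfiesAll : Literals N → Constraint N → Set
SatisfiesAll A Γ = ∀ {δ} → Γ δ → Satisfies A δ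

Interpretation : ℕ → Set
Interpretation = Subset

total : Interpretation N → Literals N
total I = ⟨T I ,F ∁ I ⟩

-- The rule  head ← b₁,…,bᵣ, not c₁,…,not cₛ  with  pos = {b₁,…,bᵣ}  and
-- neg = {c₁,…,cₛ}.
record Rule (N : ℕ) : Set where
  constructor _←_,not_
  field
    head : Fin N
    pos  : Subset N
    neg  : Subset N

open Rule public

ruleNogood : Rule N → Nogood N
ruleNogood r = ⟨T pos r ,F ⁅ head r ⁆ ∪ neg r ⟩

record Program (N : ℕ) : Set₁ where
  field
    rules   : Pred (Rule N) 0ℓ
    nogoods : Constraint N

open Program public

infixl 6 _∪ᴺ_

_∪ᴺ_ : Program N → Constraint N → Program N
P ∪ᴺ Γ = record { rules = rules P ; nogoods = nogoods P U.∪ Γ }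

heads : Program N → Pred (Fin N) 0ℓ
heads P a = ∃[ r ] rules P r × head r ≡ a

SatisfiesRules : Interpretation N → Pred (Rule N) 0ℓ → Set
SatisfiesRules I R = ∀ {r} → R r → Satisfies (total I) (ruleNogood r)

Model : Program N → Interpretation N → Set
Model P I = SatisfiesRules I (rules P) × SatisfiesAll (total I) (nogoods P)

reduct : Program N → Interpretation N → Pred (Rule N) 0ℓ
reduct P I r′ =
  ∃[ r ] rules P r × Empty (neg r ∩ I) × r′ ≡ (head r ← pos r ,not ⊥)

-- The interpretations among which an answer set I has to be minimal.
Competitor : Program N → Interpretation N → Interpretation N → Set
Competitor P I J =
  SatisfiesRules J (reduct P I) ×
  ((_∈ J) U.∖ heads P) U.≐ ((_∈ I) U.∖ heads P)

AnswerSet : Program N → Interpretation N → Set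
AnswerSet P I =
  Model P I ×
  Competitor P I I × (∀ J → Competitor P I J → J ⊆ I → J ≡ I)

SupportedModel : Program N → Interpretation N → Set
SupportedModel P I =
  Model P I ×
  (∀ {a} → a ∈ I →
    ∃[ r ] rules P r × head r ≡ a × pos r ⊆ I × Empty (neg r ∩ I))

Γsupp : Program N → Constraint N
Γsupp P δ = ∃[ I ] ¬ SupportedModel P I × δ ≡ total I

-- The proof of conflict is an irrelevant argument, so that the nogood depends
-- only on the assignment.
record Propagator (Γ : Constraint N) : Set where
  field
    π           : (A : Assignment N) → .(InConflict A Γ) → Nogood N
    π-∈         : ∀ A .(c : InConflict A Γ) → Γ (π A c)
    π-conflicts : ∀ A .(c : InConflict A Γ) → ConflictsWith A (π A c)

open Propagator public

record CallHistory (P : Program N) {Γ : Constraint N} (p : Propagator Γ)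
                   (A : Vector (Assignment N) m) : Set where
  field
    conflicts     : ∀ i → InConflict (A i) Γ
    satisfiesSupp : ∀ i → SatisfiesAll (literals (A i)) (Γsupp P)
    satisfiesPrev : ∀ i j → j < i →
                    Satisfies (literals (A i)) (π p (A j) (conflicts j))

  learned : Constraint N
  learned δ = ∃[ i ] δ ≡ π p (A i) (conflicts i)

-- The proviso that P ∪ᴺ Γ has no answer set is left implicit: it follows, since
-- learned is contained in Γ and adding nogoods creates no answer sets.
Complete : {P : Program N} {Γ : Constraint N} {p : Propagator Γ}
           {A : Vector (Assignment N) m} → CallHistory P p A → Set
Complete {P = P} h = ¬ ∃ (AnswerSet (P ∪ᴺ CallHistory.learned h))

module _ (n : ℕ) where

  -- The signature {t, x₁,…,xₙ, x′₁,…,x′ₙ}, in this order.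
  binomialSize : ℕ
  binomialSize = suc (n + n)

  t : Fin binomialSize
  t = zero

  x x′ : Fin n → Fin binomialSize
  x  i = suc (i ↑ˡ n)
  x′ i = suc (n ↑ʳ i)

  -- { x i ∣ i ∈ X }
  xs : Subset n → Subset binomialSize
  xs X = outside ∷ (X ++ ⊥)

  data BinomialRule : Pred (Rule binomialSize) 0ℓ where
    fact  : BinomialRule (t ← ⊥ ,not ⊥)
    x-in  : ∀ i → BinomialRule (x i ← ⁅ t ⁆ ,not ⁅ x′ i ⁆)
    x-out : ∀ i → BinomialRule (x′ i ← ⊥ ,not ⁅ x i ⁆)

  binomialProgram : ℕ → Program binomialSize
  binomialProgram k = record
    { rules   = BinomialRule
    ; nogoods = λ δ → ∃[ X ] ∣ X ∣ ≡ n ∸ k + 1 × δ ≡ ⟨T ⊥ ,F xs X ⟩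
    }

  -- { {T x ∣ x ∈ X} ∣ X ⊆ {x₁,…,xₙ}, ∣X∣ = k }
  fewerThan : ℕ → Constraint binomialSize
  fewerThan k δ = ∃[ X ] ∣ X ∣ ≡ k × δ ≡ ⟨T xs X ,F ⊥ ⟩

{-# OPTIONS --safe #-}

-- The nogood learned from each A i is {T x ∣ x ∈ X i} with ∣ X i ∣ = k, and the
-- sets X i are distinct because A i conflicts with its own nogood but satisfies
-- the earlier ones.  Every k-subset X occurs among them: {t} ∪ {x i ∣ i ∈ X} ∪
-- {x′ i ∣ i ∉ X} is an answer set of the binomial program that satisfies the
-- nogood of every other k-subset, so completeness forces that of X to be
-- learned.

module Submission where

open import Defs
open import Data.Bool.Properties using () renaming (_≟_ to _≟ᵇ_)
import Data.Empty as Empty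
open import Data.Fin.Base using (Fin; suc; _↑ˡ_; _↑ʳ_; splitAt)
open import Data.Fin.Properties using (any?; join-splitAt; <-cmp)
open import Data.Fin.Subset
  using (Subset; _∈_; _∉_; _⊆_; ⊥; ⁅_⁆; ∁; _∩_; _∪_; ∣_∣; inside; outside)
open import Data.Fin.Subset.Properties
  using ( ∉⊥; x∈⁅x⁆; x∈⁅y⁆⇒x≡y; _∈?_; ⊆-antisym; nonempty?; x∈p∩q⁺; x∈p∩q⁻
        ; x∈p∪q⁺; x∈p∪q⁻; x∈∁p⇒x∉p; x∉p⇒x∈∁p; x∉∁p⇒x∈p; p⊆q⇒∣p∣≤∣q∣
        ; p⊂q⇒∣p∣<∣q∣; ∣∁p∣≡n∸∣p∣)
open import Data.List.Base using (List; []; _∷_; [_]; _++_; map; length; tabulate)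
import Data.List.Membership.Propositional as List
open import Data.List.Membership.Propositional.Properties
  using (∈-map⁺; ∈-map⁻; ∈-++⁺ˡ; ∈-++⁺ʳ; ∈-++⁻; ∈-tabulate⁺; ∈-tabulate⁻)
open import Data.List.Membership.Propositional.Properties.WithK
  using (unique∧set⇒bag)
open import Data.List.Properties using (length-++; length-map; length-tabulate)
open import Data.List.Relation.Binary.BagAndSetEquality using (∼bag⇒↭)
open import Data.List.Relation.Binary.Permutation.Propositional.Properties
  using (↭-length)
open import Data.List.Relation.Unary.All using ([])
open import Data.List.Relation.Unary.AllPairs using ([]; _∷_)
open import Data.List.Relation.Unary.Any using (here)
open import Data.List.Relation.Unary.Unique.Propositional using (Unique)
import Data.List.Relation.Unary.Unique.Propositional.Properties as Unique
open import Data.Nat.Base using (ℕ; zero; suc; _+_; _∸_; _≤_)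
open import Data.Nat.Combinatorics using (_C_; nCk+nC[k+1]≡[n+1]C[k+1])
open import Data.Nat.Properties
  using (suc-injective; +-comm; <-irrefl; ≤-trans; ≤-reflexive)
open import Data.Product.Base using (_×_; _,_; proj₁; proj₂; ∃-syntax)
open import Data.Sum.Base using (inj₁; inj₂)
open import Data.Vec.Base as Vec using ([]; _∷_; here; there)
open import Data.Vec.Functional using (Vector)
open import Data.Vec.Properties
  using (∷-injectiveʳ; ≡-dec; lookup-++ˡ; lookup-++ʳ; lookup⇒[]=; []=⇒lookup)
open import Function.Base using (_∘_; id)
open import Function.Bundles using (mk⇔)
open import Relation.Binary.Definitions using (tri<; tri≈; tri>)
open import Relation.Binary.PropositionalEquality
  using (_≡_; refl; sym; trans; cong; cong₂; subst; module ≡-Reasoning)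
open import Relation.Nullary using (¬_; yes; no; contradiction)

private
  variable
    N m n k : ℕ

-- Enumeration of the subsets of a given size.

-- The clauses split on whether the first element is chosen, which is Pascal's rule; the length is
-- then `n C k` by the matching recurrence for binomial coefficients.
subsetsOfSize : ∀ n → ℕ → List (Subset n)
subsetsOfSize zero    zero    = [ [] ]
subsetsOfSize zero    (suc k) = []
subsetsOfSize (suc n) zero    = map (outside ∷_) (subsetsOfSize n zero)
subsetsOfSize (suc n) (suc k) =
  map (inside ∷_) (subsetsOfSize n k) ++
  map (outside ∷_) (subsetsOfSize n (suc k))

length-subsetsOfSize : ∀ n k → length (subsetsOfSize n k) ≡ n C k
length-subsetsOfSize zero    zero    = refl
length-subsetsOfSize zero    (suc k) = refl
length-subsetsOfSize (suc n) zero    =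
  trans (length-map (outside ∷_) (subsetsOfSize n zero))
        (length-subsetsOfSize n zero)
length-subsetsOfSize (suc n) (suc k) = begin
  length (map (inside ∷_) ins ++ map (outside ∷_) outs)
    ≡⟨ length-++ (map (inside ∷_) ins) ⟩
  length (map (inside ∷_) ins) + length (map (outside ∷_) outs)
    ≡⟨ cong₂ _+_ (length-map _ ins) (length-map _ outs) ⟩
  length ins + length outs
    ≡⟨ cong₂ _+_ (length-subsetsOfSize n k) (length-subsetsOfSize n (suc k)) ⟩
  n C k + n C suc k
    ≡⟨ nCk+nC[k+1]≡[n+1]C[k+1] n k ⟩
  suc n C suc k ∎
  where
  open ≡-Reasoning
  ins  = subsetsOfSize n k
  outs = subsetsOfSize n (suc k)

∈-subsetsOfSize⁺ : (X : Subset n) → ∣ X ∣ ≡ k → X List.∈ subsetsOfSize n k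
∈-subsetsOfSize⁺ {k = zero}  []            _  = here refl
∈-subsetsOfSize⁺ {k = zero}  (outside ∷ X) eq =
  ∈-map⁺ (outside ∷_) (∈-subsetsOfSize⁺ X eq)
∈-subsetsOfSize⁺ {k = suc k} (outside ∷ X) eq =
  ∈-++⁺ʳ _ (∈-map⁺ (outside ∷_) (∈-subsetsOfSize⁺ X eq))
∈-subsetsOfSize⁺ {k = suc k} (inside ∷ X)  eq =
  ∈-++⁺ˡ (∈-map⁺ (inside ∷_) (∈-subsetsOfSize⁺ X (suc-injective eq)))

∈-subsetsOfSize⁻ : ∀ n k {X} → X List.∈ subsetsOfSize n k → ∣ X ∣ ≡ k
∈-subsetsOfSize⁻ zero    zero    (here refl) = refl
∈-subsetsOfSize⁻ (suc n) zero    X∈ with _ , Y∈ , refl ← ∈-map⁻ (outside ∷_) X∈ =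
  ∈-subsetsOfSize⁻ n zero Y∈
∈-subsetsOfSize⁻ (suc n) (suc k) X∈
  with ∈-++⁻ (map (inside ∷_) (subsetsOfSize n k)) X∈
... | inj₁ X∈ins  with _ , Y∈ , refl ← ∈-map⁻ (inside ∷_) X∈ins =
  cong suc (∈-subsetsOfSize⁻ n k Y∈)
... | inj₂ X∈outs with _ , Y∈ , refl ← ∈-map⁻ (outside ∷_) X∈outs =
  ∈-subsetsOfSize⁻ n (suc k) Y∈

subsetsOfSize-unique : ∀ n k → Unique (subsetsOfSize n k)
subsetsOfSize-unique zero    zero    = [] ∷ []
subsetsOfSize-unique zero    (suc k) = []
subsetsOfSize-unique (suc n) zero    =
  Unique.map⁺ ∷-injectiveʳ (subsetsOfSize-unique n zero)
subsetsOfSize-unique (suc n) (suc k) = Unique.++⁺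
  (Unique.map⁺ ∷-injectiveʳ (subsetsOfSize-unique n k))
  (Unique.map⁺ ∷-injectiveʳ (subsetsOfSize-unique n (suc k)))
  λ (X∈ins , X∈outs) → disjoint (∈-map⁻ _ X∈ins) (∈-map⁻ _ X∈outs)
  where
  disjoint : ∀ {X : Subset (suc n)} {P Q : Subset n → Set} →
             (∃[ Y ] P Y × X ≡ inside ∷ Y) → ¬ (∃[ Y ] Q Y × X ≡ outside ∷ Y)
  disjoint (_ , _ , refl) (_ , _ , ())

-- Two duplicate-free lists with the same members are equal as bags, hence permutations of one
-- another, hence of equal length.
enumeration-length : (f : Fin m → Subset n) → (∀ i → ∣ f i ∣ ≡ k) →
                     (∀ {i j} → f i ≡ f j → i ≡ j) →
                     (∀ X → ∣ X ∣ ≡ k → ∃[ i ] f i ≡ X) →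
                     m ≡ n C k
enumeration-length {m} {n} {k} f ∣f∣≡k injective surjective = begin
  m                          ≡⟨ length-tabulate f ⟨
  length (tabulate f)        ≡⟨ ↭-length (∼bag⇒↭ (unique∧set⇒bag
                                  (Unique.tabulate⁺ injective)
                                  (subsetsOfSize-unique n k) (mk⇔ to from))) ⟩
  length (subsetsOfSize n k) ≡⟨ length-subsetsOfSize n k ⟩
  n C k                      ∎
  where
  open ≡-Reasoning
  to : ∀ {X} → X List.∈ tabulate f → X List.∈ subsetsOfSize n k
  to X∈ with i , refl ← ∈-tabulate⁻ X∈ = ∈-subsetsOfSize⁺ (f i) (∣f∣≡k i)
  from : ∀ {X} → X List.∈ subsetsOfSize n k → X List.∈ tabulate f
  from {X} X∈ with i , refl ← surjective X (∈-subsetsOfSize⁻ n k X∈) =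
    ∈-tabulate⁺ i

-- Cardinality arguments for finite subsets.

-- Otherwise `p ⊆ q`, and the inclusion cannot be strict because the sizes agree.
∣p∣≡∣q∣∧p≢q⇒p⊈q : {p q : Subset n} → ∣ p ∣ ≡ ∣ q ∣ → ¬ p ≡ q →
                 ∃[ i ] i ∈ p × i ∉ q
∣p∣≡∣q∣∧p≢q⇒p⊈q {p = p} {q} ∣p∣≡∣q∣ p≢q with nonempty? (p ∩ ∁ q)
... | yes (i , i∈) with i∈p , i∈∁q ← x∈p∩q⁻ p (∁ q) i∈ = i , i∈p , x∈∁p⇒x∉p i∈∁q
... | no  p∩∁q≡∅ = contradiction (⊆-antisym p⊆q q⊆p) p≢q
  where
  p⊆q : p ⊆ q
  p⊆q {i} i∈p = x∉∁p⇒x∈p λ i∈∁q → p∩∁q≡∅ (i , x∈p∩q⁺ (i∈p , i∈∁q))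
  q⊆p : q ⊆ p
  q⊆p {i} i∈q with i ∈? p
  ... | yes i∈p = i∈p
  ... | no  i∉p =
    contradiction (p⊂q⇒∣p∣<∣q∣ (p⊆q , i , i∈q , i∉p)) (<-irrefl ∣p∣≡∣q∣)

-- Pigeonhole: a `q` disjoint from `p` would lie in `∁ p`, which has one element fewer than `q`.
∣q∣≡1+n∸∣p∣⇒p∩q≢∅ : (p q : Subset n) → ∣ q ∣ ≡ n ∸ ∣ p ∣ + 1 →
                   ∃[ i ] i ∈ p × i ∈ q
∣q∣≡1+n∸∣p∣⇒p∩q≢∅ {n} p q ∣q∣≡ with nonempty? (p ∩ q)
... | yes (i , i∈) = i , x∈p∩q⁻ p q i∈
... | no  p∩q≡∅    = contradiction
  (≤-trans (≤-reflexive 1+∣∁p∣≡∣q∣) (p⊆q⇒∣p∣≤∣q∣ q⊆∁p)) (<-irrefl refl)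
  where
  q⊆∁p : q ⊆ ∁ p
  q⊆∁p {i} i∈q = x∉p⇒x∈∁p λ i∈p → p∩q≡∅ (i , x∈p∩q⁺ (i∈p , i∈q))
  1+∣∁p∣≡∣q∣ : suc ∣ ∁ p ∣ ≡ ∣ q ∣
  1+∣∁p∣≡∣q∣ = begin
    suc ∣ ∁ p ∣     ≡⟨ cong suc (∣∁p∣≡n∸∣p∣ p) ⟩
    1 + (n ∸ ∣ p ∣) ≡⟨ +-comm 1 (n ∸ ∣ p ∣) ⟩
    n ∸ ∣ p ∣ + 1   ≡⟨ ∣q∣≡ ⟨
    ∣ q ∣           ∎
    where open ≡-Reasoning

-- Membership in concatenated subsets.

∈-↑ˡ⁺ : (p : Subset m) (q : Subset n) {i : Fin m} → i ∈ p → i ↑ˡ n ∈ p Vec.++ q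
∈-↑ˡ⁺ p q {i} i∈p = lookup⇒[]= _ _ (trans (lookup-++ˡ p q i) ([]=⇒lookup i∈p))

∈-↑ˡ⁻ : (p : Subset m) (q : Subset n) {i : Fin m} → i ↑ˡ n ∈ p Vec.++ q → i ∈ p
∈-↑ˡ⁻ p q {i} i∈ = lookup⇒[]= _ _ (trans (sym (lookup-++ˡ p q i)) ([]=⇒lookup i∈))

∈-↑ʳ⁺ : (p : Subset m) (q : Subset n) {i : Fin n} → i ∈ q → m ↑ʳ i ∈ p Vec.++ q
∈-↑ʳ⁺ p q {i} i∈q = lookup⇒[]= _ _ (trans (lookup-++ʳ p q i) ([]=⇒lookup i∈q))

∈-↑ʳ⁻ : (p : Subset m) (q : Subset n) {i : Fin n} → m ↑ʳ i ∈ p Vec.++ q → i ∈ q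
∈-↑ʳ⁻ p q {i} i∈ = lookup⇒[]= _ _ (trans (sym (lookup-++ʳ p q i)) ([]=⇒lookup i∈))

-- Conflict and satisfaction along a call history.

-- The atom witnessing satisfaction has one sign in `δ` and the opposite sign in `A`; conflict puts
-- the sign from `δ` into `A` as well, against consistency.
conflict⇒¬satisfies : (A : Assignment N) {δ : Nogood N} →
                      ConflictsWith A δ → ¬ Satisfies (literals A) δ
conflict⇒¬satisfies (assignment _ consistent) (T⊆ , F⊆) (a , inj₁ (a∈T , a∈F)) =
  Empty.⊥-elim-irr (consistent (a , x∈p∩q⁺ (T⊆ a∈T , a∈F)))
conflict⇒¬satisfies (assignment _ consistent) (T⊆ , F⊆) (a , inj₂ (a∈F , a∈T)) =
  Empty.⊥-elim-irr (consistent (a , x∈p∩q⁺ (a∈T , F⊆ a∈F)))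

learned-injective : {P : Program N} {Γ : Constraint N} {p : Propagator Γ}
                    {A : Vector (Assignment N) m} (h : CallHistory P p A) →
                    let open CallHistory h in
                    ∀ {i j} → π p (A i) (conflicts i) ≡ π p (A j) (conflicts j) →
                    i ≡ j
learned-injective {p = p} {A} h {i} {j} eq with <-cmp i j
... | tri≈ _ i≡j _ = i≡j
... | tri< i<j _ _ = contradiction
  -- The later assignment `A j` satisfies the nogood learned at `i`, which by `eq` is its own.
  (subst (Satisfies _) eq (CallHistory.satisfiesPrev h j i i<j))
  (conflict⇒¬satisfies (A j) (π-conflicts p (A j) (CallHistory.conflicts h j)))
... | tri> _ _ j<i = contradiction
  (subst (Satisfies _) (sym eq) (CallHistory.satisfiesPrev h i j j<i))
  (conflict⇒¬satisfies (A i) (π-conflicts p (A i) (CallHistory.conflicts h i)))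

-- Rules of the reduct.

-- A rule survives in the reduct only if `neg r` misses `I`, so the witness for the original rule is
-- never a true atom of `neg r` and still serves after `neg r` is dropped.
model-reduct : (P : Program N) {I : Interpretation N} →
               SatisfiesRules I (rules P) → SatisfiesRules I (reduct P I)
model-reduct P sat (r , r∈P , neg∩I≡∅ , refl) with sat r∈P
... | a , inj₁ a∈pos×a∉I = a , inj₁ a∈pos×a∉I
... | a , inj₂ (a∈ , a∈I) with x∈p∪q⁻ ⁅ head r ⁆ (neg r) a∈
...   | inj₁ a∈head = a , inj₂ (x∈p∪q⁺ (inj₁ a∈head) , a∈I)
...   | inj₂ a∈neg  = contradiction (a , x∈p∩q⁺ (a∈neg , a∈I)) neg∩I≡∅

-- Forward chaining: once the positive body holds in `J`, only the head can witness satisfaction of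
-- the reduced rule. Negative bodies are tested against `I`, positive ones against `J`.
reduct-head : (P : Program N) {I J : Interpretation N} →
              SatisfiesRules J (reduct P I) →
              ∀ {r} → rules P r → (∀ {a} → a ∈ neg r → a ∉ I) → pos r ⊆ J →
              head r ∈ J
reduct-head P sat {r} r∈P neg∉I pos⊆J
  with sat (r , r∈P , (λ (a , a∈) → let a∈neg , a∈I = x∈p∩q⁻ (neg r) _ a∈
                                    in neg∉I a∈neg a∈I) , refl)
... | a , inj₁ (a∈pos , a∈∁J) = contradiction (pos⊆J a∈pos) (x∈∁p⇒x∉p a∈∁J)
... | a , inj₂ (a∈ , a∈J) with x∈p∪q⁻ ⁅ head r ⁆ ⊥ a∈
...   | inj₁ a∈head = subst (_∈ _) (x∈⁅y⁆⇒x≡y _ a∈head) a∈J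
...   | inj₂ a∈⊥    = contradiction a∈⊥ ∉⊥

-- Answer sets of the binomial program.

choice : Subset n → Interpretation (binomialSize n)
choice X = inside ∷ (X Vec.++ ∁ X)

module _ {n : ℕ} (X : Subset n) where

  x∈choice⁺ : ∀ {i} → i ∈ X → x n i ∈ choice X
  x∈choice⁺ i∈X = there (∈-↑ˡ⁺ X (∁ X) i∈X)

  x∈choice⁻ : ∀ {i} → x n i ∈ choice X → i ∈ X
  x∈choice⁻ (there i∈) = ∈-↑ˡ⁻ X (∁ X) i∈

  x′∈choice⁺ : ∀ {i} → i ∉ X → x′ n i ∈ choice X
  x′∈choice⁺ i∉X = there (∈-↑ʳ⁺ X (∁ X) (x∉p⇒x∈∁p i∉X))

  x′∈choice⁻ : ∀ {i} → x′ n i ∈ choice X → i ∉ X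
  x′∈choice⁻ (there i∈) = x∈∁p⇒x∉p (∈-↑ʳ⁻ X (∁ X) i∈)

  -- Both rules for `i` have `x n i` and `x′ n i` in the `F` part of their nogood, and one of these
  -- two atoms is true, so the same witness serves both.
  choice-satisfiesRules : SatisfiesRules (choice X) (BinomialRule n)
  choice-satisfiesRules fact = t n , inj₂ (here , here)
  choice-satisfiesRules (x-in i) with i ∈? X
  ... | yes i∈X = x n i , inj₂ (x∈p∪q⁺ (inj₁ (x∈⁅x⁆ (x n i))) , x∈choice⁺ i∈X)
  ... | no  i∉X = x′ n i ,
    inj₂ (x∈p∪q⁺ {p = ⁅ x n i ⁆} (inj₂ (x∈⁅x⁆ (x′ n i))) , x′∈choice⁺ i∉X)
  choice-satisfiesRules (x-out i) with i ∈? X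
  ... | yes i∈X = x n i ,
    inj₂ (x∈p∪q⁺ {p = ⁅ x′ n i ⁆} (inj₂ (x∈⁅x⁆ (x n i))) , x∈choice⁺ i∈X)
  ... | no  i∉X = x′ n i , inj₂ (x∈p∪q⁺ (inj₁ (x∈⁅x⁆ (x′ n i))) , x′∈choice⁺ i∉X)

  -- Each atom of `choice X` is derived in the reduct: first `t`, then `x n i` or `x′ n i`, whose
  -- blocking atom lies outside `choice X`. Only the rules of `P` are fixed, so that learned nogoods
  -- may be added to it.
  choice-least : (P : Program (binomialSize n)) → rules P ≡ BinomialRule n →
                 ∀ {J} → SatisfiesRules J (reduct P (choice X)) → choice X ⊆ J
  choice-least P refl {J} sat {a} a∈ = least a a∈
    where
    derive : ∀ {r} → BinomialRule n r → (∀ {a} → a ∈ neg r → a ∉ choice X) →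
             pos r ⊆ J → head r ∈ J
    derive = reduct-head P sat
    t∈J : t n ∈ J
    t∈J = derive fact (λ a∈⊥ → contradiction a∈⊥ ∉⊥) (λ a∈⊥ → contradiction a∈⊥ ∉⊥)
    least : ∀ a → a ∈ choice X → a ∈ J
    least Fin.zero _ = t∈J
    -- Matching `join-splitAt` against `refl` turns `suc a` into `x n i` or `x′ n i`.
    least (suc a) a∈ with splitAt n a | join-splitAt n n a
    ... | inj₁ i | refl = derive (x-in i)
      (λ b∈ b∈I → x′∈choice⁻ (subst (_∈ choice X) (x∈⁅y⁆⇒x≡y _ b∈) b∈I)
                             (x∈choice⁻ a∈))
      (λ b∈ → subst (_∈ J) (sym (x∈⁅y⁆⇒x≡y _ b∈)) t∈J)
    ... | inj₂ i | refl = derive (x-out i)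
      (λ b∈ b∈I → x′∈choice⁻ a∈
        (x∈choice⁻ (subst (_∈ choice X) (x∈⁅y⁆⇒x≡y _ b∈) b∈I)))
      (λ b∈⊥ → contradiction b∈⊥ ∉⊥)

  choice-answerSet : (P : Program (binomialSize n)) → rules P ≡ BinomialRule n →
                     SatisfiesAll (total (choice X)) (nogoods P) →
                     AnswerSet P (choice X)
  choice-answerSet P refl sat =
    (choice-satisfiesRules , sat) ,
    (model-reduct P choice-satisfiesRules , (id , id)) ,
    -- Leastness gives minimality: a competitor inside `choice X` also contains it.
    λ J (satJ , _) J⊆ → ⊆-antisym J⊆ (choice-least P refl satJ)

  -- `Y` has one element more than `X` leaves out, so it meets `X` in an index whose atom is true.
  choice-satisfies-atLeast : (Y : Subset n) → ∣ Y ∣ ≡ n ∸ ∣ X ∣ + 1 →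
                             Satisfies (total (choice X)) ⟨T ⊥ ,F xs n Y ⟩
  choice-satisfies-atLeast Y ∣Y∣≡
    with i , i∈X , i∈Y ← ∣q∣≡1+n∸∣p∣⇒p∩q≢∅ X Y ∣Y∣≡ =
    x n i , inj₂ (there (∈-↑ˡ⁺ Y ⊥ i∈Y) , x∈choice⁺ i∈X)

  -- A set of the same size as `X` but different from it has an element outside `X`, whose atom is
  -- false.
  choice-satisfies-fewer : (Y : Subset n) → ∣ Y ∣ ≡ ∣ X ∣ → ¬ Y ≡ X →
                           Satisfies (total (choice X)) ⟨T xs n Y ,F ⊥ ⟩
  choice-satisfies-fewer Y ∣Y∣≡∣X∣ Y≢X
    with i , i∈Y , i∉X ← ∣p∣≡∣q∣∧p≢q⇒p⊈q ∣Y∣≡∣X∣ Y≢X =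
    x n i , inj₁ (there (∈-↑ˡ⁺ Y ⊥ i∈Y) , x∉p⇒x∈∁p (i∉X ∘ x∈choice⁻))

-- Counting the learned nogoods.

proposition2 : (n k m : ℕ) → k ≤ n →
    (π : Propagator (fewerThan n k))
    (A : Vector (Assignment (binomialSize n)) m)
    (h : CallHistory (binomialProgram n k) π A) →
    Complete h →
    m ≡ n C k
proposition2 n k m _ p A h complete =
  enumeration-length X ∣X∣≡k
    (λ {i} {j} Xᵢ≡Xⱼ → learned-injective h (trans (π≡ i)
      (trans (cong (λ Y → ⟨T xs n Y ,F ⊥ ⟩) Xᵢ≡Xⱼ) (sym (π≡ j)))))
    surjective
  where
  open CallHistory h
  X : Fin m → Subset n
  X i = proj₁ (π-∈ p (A i) (conflicts i))
  ∣X∣≡k : ∀ i → ∣ X i ∣ ≡ k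
  ∣X∣≡k i = proj₁ (proj₂ (π-∈ p (A i) (conflicts i)))
  π≡ : ∀ i → π p (A i) (conflicts i) ≡ ⟨T xs n (X i) ,F ⊥ ⟩
  π≡ i = proj₂ (proj₂ (π-∈ p (A i) (conflicts i)))
  surjective : ∀ Y → ∣ Y ∣ ≡ k → ∃[ i ] X i ≡ Y
  -- Matching `refl` replaces `k` by `∣ Y ∣`, the form that the lemmas on `choice` expect.
  -- Completeness is only a negation, so the index comes from a decidable search through the `X i`.
  surjective Y refl with any? (λ i → ≡-dec _≟ᵇ_ (X i) Y)
  ... | yes Y∈X = Y∈X
  ... | no  Y∉X =
    contradiction (choice Y , choice-answerSet Y P refl sat) complete
    where
    P : Program (binomialSize n)
    P = binomialProgram n k ∪ᴺ learned
    sat : SatisfiesAll (total (choice Y)) (nogoods P)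
    sat (inj₁ (Z , ∣Z∣≡ , refl)) = choice-satisfies-atLeast Y Z ∣Z∣≡
    sat (inj₂ (i , refl)) = subst (Satisfies _) (sym (π≡ i))
      (choice-satisfies-fewer Y (X i) (∣X∣≡k i) (λ Xᵢ≡Y → Y∉X (i , Xᵢ≡Y)))
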